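{- For every integer $n \geq 1$, the complete bipartite graphs $K_{2,n}$ and $K_{3,n}$ are stable, i.e., all roots of their independence polynomials lie in the closed left half-plane $\{z \in \mathbb{C} : \mathrm{Re}(z) \leq 0\}$.
   Context: For a simple graph $G$, the independence polynomial is $i(G,x)=\sum_{k=0}^{\alpha(G)} i_k(G)x^k$, where $i_k(G)$ is the number of independent sets of size $k$ in $G$ (with $i_0(G)=1$) and $\alpha(G)$ is the independence number. A graph $G$ is called stable if every root $z$ of $i(G,x)$ satisfies $\mathrm{Re}(z)\leq 0$. For the complete bipartite graph $K_{m,n}$ one has $i(K_{m,n},x)=(1+x)^n+(1+x)^m-1$. -}

module Defs where

open import Algebra.Bundles using (RawRing)
import Algebra.Definitions.RawSemiring as RawSemiringDefs
open import Data.Bool.Base using (Bool; true; false)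
import Data.Bool.Properties as Bool
open import Data.Fin.Base using (Fin; toℕ; splitAt)
open import Data.Fin.Properties using (all?)
open import Data.Fin.Subset using (Subset; _∈_; ∣_∣; inside; outside)
open import Data.Fin.Subset.Properties using (_∈?_)
open import Data.List.Base using (List; []; _∷_; _++_; map; filter; length)
open import Data.List.Extrema.Nat using (max)
open import Data.Nat.Base as ℕ using (ℕ; zero; suc; _⊔_)
import Data.Nat.Properties as ℕ
open import Data.Product.Base using (∃-syntax; _×_; _,_)
open import Data.Rational.Base as ℚ using (ℚ; 0ℚ; 1ℚ; ½)
import Data.Rational.Properties as ℚ
open import Data.Rational.Solver using (module +-*-Solver)
open import Data.Sum.Base using ([_,_]′)
open import Data.Vec.Base using ([]; _∷_)
open import Function.Base using (const)
open import Level using (0ℓ)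
open import Relation.Binary.Core using (Rel)
open import Relation.Binary.Definitions using (Symmetric; Irreflexive; Decidable)
open import Relation.Binary.PropositionalEquality
  using (_≡_; _≢_; refl; sym; cong; subst; ≢-sym; module ≡-Reasoning)
open import Relation.Nullary.Decidable using (¬?; _→-dec_)
open import Relation.Nullary.Negation.Core using (¬_)
import Relation.Unary as Unary

Eventually : (ℕ → Set) → Set
Eventually P = ∃[ N ] (∀ n → N ℕ.≤ n → P n)

IsCauchy : (ℕ → ℚ) → Set
IsCauchy s = ∀ ε → 0ℚ ℚ.< ε →
  ∃[ N ] (∀ m n → N ℕ.≤ m → N ℕ.≤ n → ℚ.∣ s m ℚ.- s n ∣ ℚ.< ε)

record ℝ : Set where
  constructor mkℝ
  field
    seq    : ℕ → ℚ
    cauchy : IsCauchy seq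

open ℝ public

-- Two Cauchy sequences represent the same real when they are related by _≈ᴿ_,
-- so equations between reals are stated with _≈ᴿ_, never with _≡_.

infix 4 _≈ᴿ_ _≤ᴿ_

_≈ᴿ_ : Rel ℝ 0ℓ
x ≈ᴿ y = ∀ ε → 0ℚ ℚ.< ε → Eventually λ n → ℚ.∣ seq x n ℚ.- seq y n ∣ ℚ.< ε

_≤ᴿ_ : Rel ℝ 0ℓ
x ≤ᴿ y = ∀ ε → 0ℚ ℚ.< ε → Eventually λ n → seq x n ℚ.< seq y n ℚ.+ ε

∣p-p∣≡0 : ∀ p → ℚ.∣ p ℚ.- p ∣ ≡ 0ℚ
∣p-p∣≡0 p = cong ℚ.∣_∣ (ℚ.+-inverseʳ p)

const-cauchy : ∀ q → IsCauchy (const q)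
const-cauchy q ε 0<ε =
  0 , λ _ _ _ _ → subst (ℚ._< ε) (sym (∣p-p∣≡0 q)) 0<ε

neg-cauchy : ∀ {s} → IsCauchy s → IsCauchy (λ n → ℚ.- s n)
neg-cauchy {s} cs ε 0<ε with cs ε 0<ε
... | N , h = N , λ m n N≤m N≤n →
  subst (ℚ._< ε) (eq (s m) (s n)) (h m n N≤m N≤n)
  where
  open +-*-Solver
  eq : ∀ a b → ℚ.∣ a ℚ.- b ∣ ≡ ℚ.∣ ℚ.- a ℚ.- (ℚ.- b) ∣
  eq a b = subst (λ c → ℚ.∣ a ℚ.- b ∣ ≡ ℚ.∣ c ∣)
    (solve 2 (λ a b → :- (a :- b) := (:- a) :- (:- b)) refl a b)
    (sym (ℚ.∣-p∣≡∣p∣ (a ℚ.- b)))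

0<½ε : ∀ {ε} → 0ℚ ℚ.< ε → 0ℚ ℚ.< ε ℚ.* ½
0<½ε 0<ε = ℚ.*-monoˡ-<-pos ½ 0<ε

add-cauchy : ∀ {s t} → IsCauchy s → IsCauchy t → IsCauchy (λ n → s n ℚ.+ t n)
add-cauchy {s} {t} cs ct ε 0<ε
  with cs (ε ℚ.* ½) (0<½ε 0<ε) | ct (ε ℚ.* ½) (0<½ε 0<ε)
... | M , h | N , k = M ⊔ N , λ m n p q →
  subst (ℚ._< ε) (cong ℚ.∣_∣ (rearrange (s m) (t m) (s n) (t n)))
    (ℚ.≤-<-trans (ℚ.∣p+q∣≤∣p∣+∣q∣ (s m ℚ.- s n) (t m ℚ.- t n))
      (subst (_ ℚ.<_) (halves ε)
        (ℚ.+-mono-<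
          (h m n (ℕ.m⊔n≤o⇒m≤o M N p) (ℕ.m⊔n≤o⇒m≤o M N q))
          (k m n (ℕ.m⊔n≤o⇒n≤o M N p) (ℕ.m⊔n≤o⇒n≤o M N q)))))
  where
  open +-*-Solver
  rearrange : ∀ a b c d →
    (a ℚ.- c) ℚ.+ (b ℚ.- d) ≡ (a ℚ.+ b) ℚ.- (c ℚ.+ d)
  rearrange = solve 4 (λ a b c d → (a :- c) :+ (b :- d) := (a :+ b) :- (c :+ d)) refl
  halves : ∀ e → e ℚ.* ½ ℚ.+ e ℚ.* ½ ≡ e
  halves = solve 1 (λ e → e :* con ½ :+ e :* con ½ := e) refl

cauchy⇒bounded : ∀ {s} → IsCauchy s →
  ∃[ B ] (0ℚ ℚ.< B × Eventually λ n → ℚ.∣ s n ∣ ℚ.< B)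
cauchy⇒bounded {s} cs with cs 1ℚ (ℚ.positive⁻¹ 1ℚ)
... | N , h = 1ℚ ℚ.+ ℚ.∣ s N ∣
  , ℚ.+-mono-<-≤ (ℚ.positive⁻¹ 1ℚ) (ℚ.0≤∣p∣ (s N))
  , N , λ n N≤n →
    subst (λ a → ℚ.∣ a ∣ ℚ.< 1ℚ ℚ.+ ℚ.∣ s N ∣) (cancel (s n) (s N))
      (ℚ.≤-<-trans (ℚ.∣p+q∣≤∣p∣+∣q∣ (s n ℚ.- s N) (s N))
        (ℚ.+-monoˡ-< ℚ.∣ s N ∣ (h n N N≤n ℕ.≤-refl)))
  where
  open +-*-Solver
  cancel : ∀ a b → (a ℚ.- b) ℚ.+ b ≡ a
  cancel = solve 2 (λ a b → (a :- b) :+ b := a) refl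

∣p*q∣<B*δ : ∀ {p q B δ} → 0ℚ ℚ.< B → ℚ.∣ p ∣ ℚ.< B → ℚ.∣ q ∣ ℚ.< δ →
  ℚ.∣ p ℚ.* q ∣ ℚ.< B ℚ.* δ
∣p*q∣<B*δ {p} {q} {B} {δ} 0<B p<B q<δ =
  subst (ℚ._< B ℚ.* δ) (sym (ℚ.∣p*q∣≡∣p∣*∣q∣ p q))
    (ℚ.≤-<-trans
      (ℚ.*-monoʳ-≤-nonNeg ℚ.∣ q ∣ {{ℚ.∣-∣-nonNeg q}} (ℚ.<⇒≤ p<B))
      (ℚ.*-monoʳ-<-pos B {{ℚ.positive 0<B}} q<δ))

split-ε : ∀ {A B ε} → 0ℚ ℚ.< A → 0ℚ ℚ.< B → 0ℚ ℚ.< ε →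
  ∃[ δ ] (0ℚ ℚ.< δ × A ℚ.* δ ℚ.+ B ℚ.* δ ≡ ε)
split-ε {A} {B} {ε} 0<A 0<B 0<ε = scale (A ℚ.+ B) refl (ℚ.+-mono-< 0<A 0<B)
  where
  scale : ∀ C → A ℚ.+ B ≡ C → 0ℚ ℚ.< C →
    ∃[ δ ] (0ℚ ℚ.< δ × A ℚ.* δ ℚ.+ B ℚ.* δ ≡ ε)
  scale C A+B≡C 0<C = invert (ℚ.1/ C) (ℚ.1/pos⇒pos C) (ℚ.*-inverseʳ C)
    where
    instance
      C-pos : ℚ.Positive C
      C-pos = ℚ.positive 0<C
      C-nonZero : ℚ.NonZero C
      C-nonZero = ℚ.pos⇒nonZero C
    invert : ∀ D → ℚ.Positive D → C ℚ.* D ≡ 1ℚ →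
      ∃[ δ ] (0ℚ ℚ.< δ × A ℚ.* δ ℚ.+ B ℚ.* δ ≡ ε)
    invert D D-pos C*D≡1 = D ℚ.* ε
      , subst (ℚ._< D ℚ.* ε) (ℚ.*-zeroʳ D) (ℚ.*-monoʳ-<-pos D {{D-pos}} 0<ε)
      , (begin
        A ℚ.* (D ℚ.* ε) ℚ.+ B ℚ.* (D ℚ.* ε) ≡⟨ ℚ.*-distribʳ-+ (D ℚ.* ε) A B ⟨
        (A ℚ.+ B) ℚ.* (D ℚ.* ε)             ≡⟨ cong (ℚ._* (D ℚ.* ε)) A+B≡C ⟩
        C ℚ.* (D ℚ.* ε)                     ≡⟨ ℚ.*-assoc C D ε ⟨
        C ℚ.* D ℚ.* ε                       ≡⟨ cong (ℚ._* ε) C*D≡1 ⟩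
        1ℚ ℚ.* ε                            ≡⟨ ℚ.*-identityˡ ε ⟩
        ε                                   ∎)
      where open ≡-Reasoning

∣ab-cd∣<ε : ∀ {A B δ ε} a b c d → 0ℚ ℚ.< A → 0ℚ ℚ.< B →
  A ℚ.* δ ℚ.+ B ℚ.* δ ≡ ε → ℚ.∣ a ∣ ℚ.< A → ℚ.∣ d ∣ ℚ.< B →
  ℚ.∣ a ℚ.- c ∣ ℚ.< δ → ℚ.∣ b ℚ.- d ∣ ℚ.< δ →
  ℚ.∣ a ℚ.* b ℚ.- c ℚ.* d ∣ ℚ.< ε
∣ab-cd∣<ε {A} {B} {δ} {ε} a b c d 0<A 0<B total a<A d<B a-c<δ b-d<δ = begin-strict
  ℚ.∣ a ℚ.* b ℚ.- c ℚ.* d ∣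
    ≡⟨ cong ℚ.∣_∣ (rearrange a b c d) ⟩
  ℚ.∣ a ℚ.* (b ℚ.- d) ℚ.+ d ℚ.* (a ℚ.- c) ∣
    ≤⟨ ℚ.∣p+q∣≤∣p∣+∣q∣ (a ℚ.* (b ℚ.- d)) (d ℚ.* (a ℚ.- c)) ⟩
  ℚ.∣ a ℚ.* (b ℚ.- d) ∣ ℚ.+ ℚ.∣ d ℚ.* (a ℚ.- c) ∣
    <⟨ ℚ.+-mono-< (∣p*q∣<B*δ {a} {b ℚ.- d} 0<A a<A b-d<δ)
                  (∣p*q∣<B*δ {d} {a ℚ.- c} 0<B d<B a-c<δ) ⟩
  A ℚ.* δ ℚ.+ B ℚ.* δ
    ≡⟨ total ⟩
  ε ∎
  where
  open ℚ.≤-Reasoning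
  open +-*-Solver
  rearrange : ∀ a b c d →
    a ℚ.* b ℚ.- c ℚ.* d ≡ a ℚ.* (b ℚ.- d) ℚ.+ d ℚ.* (a ℚ.- c)
  rearrange = solve 4 (λ a b c d →
    a :* b :- c :* d := a :* (b :- d) :+ d :* (a :- c)) refl

mul-cauchy : ∀ {s t} → IsCauchy s → IsCauchy t → IsCauchy (λ n → s n ℚ.* t n)
mul-cauchy {s} {t} cs ct ε 0<ε =
  let A , 0<A , K , boundˢ = cauchy⇒bounded {s} cs
      B , 0<B , L , boundᵗ = cauchy⇒bounded {t} ct
      δ , 0<δ , total      = split-ε 0<A 0<B 0<ε
      M , h = cs δ 0<δ
      N , k = ct δ 0<δ
  in (K ⊔ L) ⊔ (M ⊔ N) , λ m n p q →
    let pl = ℕ.m⊔n≤o⇒m≤o (K ⊔ L) (M ⊔ N) p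
        pr = ℕ.m⊔n≤o⇒n≤o (K ⊔ L) (M ⊔ N) p
        ql = ℕ.m⊔n≤o⇒m≤o (K ⊔ L) (M ⊔ N) q
        qr = ℕ.m⊔n≤o⇒n≤o (K ⊔ L) (M ⊔ N) q
    in ∣ab-cd∣<ε (s m) (t m) (s n) (t n) 0<A 0<B total
         (boundˢ m (ℕ.m⊔n≤o⇒m≤o K L pl))
         (boundᵗ n (ℕ.m⊔n≤o⇒n≤o K L ql))
         (h m n (ℕ.m⊔n≤o⇒m≤o M N pr) (ℕ.m⊔n≤o⇒m≤o M N qr))
         (k m n (ℕ.m⊔n≤o⇒n≤o M N pr) (ℕ.m⊔n≤o⇒n≤o M N qr))

infixl 6 _+ᴿ_ _-ᴿ_
infixl 7 _*ᴿ_
infix  8 -ᴿ_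

fromℚ : ℚ → ℝ
fromℚ q = mkℝ (const q) (const-cauchy q)

0ᴿ 1ᴿ : ℝ
0ᴿ = fromℚ 0ℚ
1ᴿ = fromℚ 1ℚ

_+ᴿ_ _*ᴿ_ : ℝ → ℝ → ℝ
x +ᴿ y = mkℝ (λ n → seq x n ℚ.+ seq y n) (add-cauchy {seq x} {seq y} (cauchy x) (cauchy y))
x *ᴿ y = mkℝ (λ n → seq x n ℚ.* seq y n) (mul-cauchy {seq x} {seq y} (cauchy x) (cauchy y))

-ᴿ_ : ℝ → ℝ
-ᴿ x = mkℝ (λ n → ℚ.- seq x n) (neg-cauchy {seq x} (cauchy x))

_-ᴿ_ : ℝ → ℝ → ℝ
x -ᴿ y = x +ᴿ (-ᴿ y)

record ℂ : Set where
  constructor _+i_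
  field
    Re Im : ℝ

open ℂ public

ℂ-rawRing : RawRing 0ℓ 0ℓ
ℂ-rawRing = record
  { Carrier = ℂ
  ; _≈_     = λ z w → (Re z ≈ᴿ Re w) × (Im z ≈ᴿ Im w)
  ; _+_     = λ z w → (Re z +ᴿ Re w) +i (Im z +ᴿ Im w)
  ; _*_     = λ z w → (Re z *ᴿ Re w -ᴿ Im z *ᴿ Im w)
                   +i (Re z *ᴿ Im w +ᴿ Im z *ᴿ Re w)
  ; -_      = λ z → (-ᴿ Re z) +i (-ᴿ Im z)
  ; 0#      = 0ᴿ +i 0ᴿ
  ; 1#      = 1ᴿ +i 0ᴿ
  }

module ℂ-Raw where
  open RawRing ℂ-rawRing public
  open RawSemiringDefs rawSemiring public using (sum; _^_) renaming (_×_ to _·_)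

record SimpleGraph (n : ℕ) : Set₁ where
  infix 4 _~_ _~?_
  field
    _~_      : Rel (Fin n) 0ℓ
    ~-sym    : Symmetric _~_
    ~-irrefl : Irreflexive _≡_ _~_
    _~?_     : Decidable _~_

subsets : ∀ n → List (Subset n)
subsets zero    = [] ∷ []
subsets (suc n) = map (outside ∷_) (subsets n) ++ map (inside ∷_) (subsets n)

module _ {n} (G : SimpleGraph n) where
  open SimpleGraph G

  Independent : Subset n → Set
  Independent S = ∀ u v → u ∈ S → v ∈ S → ¬ (u ~ v)

  independent? : Unary.Decidable Independent
  independent? S = all? λ u → all? λ v →
    (u ∈? S) →-dec ((v ∈? S) →-dec ¬? (u ~? v))

  independentSets : List (Subset n)
  independentSets = filter independent? (subsets n)

  independentCount : ℕ → ℕ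
  independentCount k = length (filter (λ S → ∣ S ∣ ℕ.≟ k) independentSets)

  independenceNumber : ℕ
  independenceNumber = max 0 (map ∣_∣ independentSets)

  independencePolynomial : ℂ → ℂ
  independencePolynomial x =
    sum {suc independenceNumber} λ k → independentCount (toℕ k) · (x ^ toℕ k)
    where open ℂ-Raw

  Stable : Set
  Stable = ∀ z → independencePolynomial z ≈ 0# → Re z ≤ᴿ 0ᴿ
    where open ℂ-Raw

-- The first m vertices form one side of the bipartition, the last n the other.
completeBipartite : ∀ m n → SimpleGraph (m ℕ.+ n)
completeBipartite m n = record
  { _~_      = λ u v → side u ≢ side v
  ; ~-sym    = ≢-sym
  ; ~-irrefl = λ { refl side≢ → side≢ refl }
  ; _~?_     = λ u v → ¬? (side u Bool.≟ side v)
  }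
  where
  side : Fin (m ℕ.+ n) → Bool
  side u = [ const false , const true ]′ (splitAt m u)

{-# OPTIONS --safe #-}
module Submission where

-- Let P(z) = (1+z)ⁿ + (1+z)ᵐ − 1.  A polynomial Q with Re z ≤ Re (P(z) · conj Q(z))
-- whenever Re z > 0 shows that no root of P has positive real part, and for
-- Cauchy sequences it is enough to have this at each rational approximation of z:
-- if P(zⱼ) → 0 then Re (P(zⱼ) · conj Q(zⱼ)) → 0, which bounds Re zⱼ from above.
--
-- For n large (n ≥ 3 if m = 2, n ≥ 5 if m = 3) take Q = wⁿ − wᵐ + 1 with w = 1+z;
-- then Re (P · conj Q) = |w|²ⁿ − |wᵐ − 1|², and wⁿ dominates because Re w > 1.
-- For the remaining n, Q is, as in the Routh–Hurwitz criterion, the even or the odd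
-- part of P: the quotient of the odd and even part of a Hurwitz polynomial has
-- positive real part on the right half-plane.

open import Defs
open import Algebra.Bundles using (RawRing; Semiring; CommutativeRing)
import Algebra.Definitions.RawSemiring as RawSemiringDefs
import Algebra.Properties.Semiring.Sum as SemiringSum
open import Algebra.Structures using (IsCommutativeSemiring)
open import Algebra.Structures.Biased using (isCommutativeSemiringˡ)
open import Data.Bool.Base using (Bool; true; false; if_then_else_)
import Data.Bool.Properties as Bool
open import Data.Fin.Base using (Fin; zero; suc; toℕ; splitAt)
open import Data.Fin.Properties using (all?)
open import Data.Fin.Subset using (Subset; _∈_; ∣_∣; inside; outside)
open import Data.Fin.Subset.Properties using (_∈?_)
open import Data.Integer.Base using (+_)
open import Data.List.Base using (List; []; _∷_; _++_; map; filter; length)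
open import Data.List.Extrema.Nat using (xs≤max)
open import Data.List.Properties using (filter-++; filter-≐; filter-none)
open import Data.List.Relation.Unary.All using (All; []; _∷_; universal)
open import Data.List.Relation.Unary.All.Properties using (map⁻)
open import Data.Nat.Base as ℕ using (ℕ; zero; suc; _≤_; z≤n; s≤s; _⊔_)
import Data.Nat.Properties as ℕ
open import Data.Product.Base using (_×_; _,_; proj₁; proj₂)
open import Data.Rational.Base as ℚ using (ℚ; 0ℚ; 1ℚ; _/_)
import Data.Rational.Properties as ℚ
open import Data.Rational.Solver using (module +-*-Solver)
open import Data.Sum.Base using ([_,_]′; inj₁; inj₂)
open import Data.Vec.Base using ([]; _∷_; here; there)
open import Function.Base using (_∘_; const)
open import Level using (0ℓ)
open import Relation.Binary.PropositionalEquality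
  using (_≡_; refl; sym; trans; cong; cong₂; subst; isEquivalence; module ≡-Reasoning)
open import Relation.Nullary.Decidable
  using (does; yes; no; _→-dec_; decidable-stable; True; toWitness)
open import Relation.Nullary.Negation.Core using (¬_; contradiction)
open import Relation.Unary using (Pred; Decidable; _≐_)

-- Independent sets of the complete bipartite graph, one left vertex at a time.

side : ∀ m n → Fin (m ℕ.+ n) → Bool
side m n u = [ const false , const true ]′ (splitAt m u)

side-suc : ∀ m n (u : Fin (m ℕ.+ n)) → side (suc m) n (suc u) ≡ side m n u
side-suc m n u with splitAt m u
... | inj₁ _ = refl
... | inj₂ _ = refl

Independentᵇ : ∀ m n → Subset (m ℕ.+ n) → Set
Independentᵇ m n = Independent (completeBipartite m n)

independentᵇ? : ∀ m n → Decidable (Independentᵇ m n)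
independentᵇ? m n = independent? (completeBipartite m n)

LeftOnly : ∀ m n → Subset (m ℕ.+ n) → Set
LeftOnly m n A = ∀ v → v ∈ A → side m n v ≡ false

leftOnly? : ∀ m n → Decidable (LeftOnly m n)
leftOnly? m n A = all? λ v → (v ∈? A) →-dec (side m n v Bool.≟ false)

-- The added vertex lies on the left, so its membership `s` imposes no condition.
leftOnly-∷ : ∀ m n s → (LeftOnly (suc m) n ∘ (s ∷_)) ≐ LeftOnly m n
leftOnly-∷ m n s =
    (λ left v v∈A → trans (sym (side-suc m n v)) (left (suc v) (there v∈A)))
  , λ where
      left zero    _           → refl
      left (suc v) (there v∈A) → trans (side-suc m n v) (left v v∈A)

independent-outside : ∀ m n →
  (Independentᵇ (suc m) n ∘ (outside ∷_)) ≐ Independentᵇ m n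
independent-outside m n =
    (λ ind u v u∈A v∈A u~v → ind (suc u) (suc v) (there u∈A) (there v∈A)
      (λ eq → u~v (trans (sym (side-suc m n u)) (trans eq (side-suc m n v)))))
  , λ where
      ind (suc u) (suc v) (there u∈A) (there v∈A) u~v → ind u v u∈A v∈A
        (λ eq → u~v (trans (side-suc m n u) (trans eq (sym (side-suc m n v)))))

-- A chosen left vertex is adjacent to every right vertex and to no left one, so it excludes exactly
-- the right side.
independent-inside : ∀ m n →
  (Independentᵇ (suc m) n ∘ (inside ∷_)) ≐ LeftOnly m n
independent-inside m n = to , from
  where
  to : ∀ {A} → Independentᵇ (suc m) n (inside ∷ A) → LeftOnly m n A
  to ind v v∈A = trans (sym (side-suc m n v)) (sym (decidable-stable
    (false Bool.≟ side (suc m) n (suc v))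
    (ind zero (suc v) here (there v∈A))))
  left : ∀ {A} → LeftOnly m n A → ∀ u → u ∈ (inside ∷ A) → side (suc m) n u ≡ false
  left {A} = proj₂ (leftOnly-∷ m n inside)
  from : ∀ {A} → LeftOnly m n A → Independentᵇ (suc m) n (inside ∷ A)
  from lo u v u∈A v∈A u~v = u~v (trans (left lo u u∈A) (sym (left lo v v∈A)))

-- Generating functions of families of subsets over a semiring.

module _ {c ℓ} (S : Semiring c ℓ) (x : Semiring.Carrier S) where
  open Semiring S renaming (zero to *-zero; refl to ≈-refl; sym to ≈-sym; trans to ≈-trans)
  open RawSemiringDefs rawSemiring using (sum; _^_) renaming (_×_ to _·_)
  open SemiringSum S using (∑-distrib-+; sum-cong-≋; sum-replicate-zero)
  open import Relation.Binary.Reasoning.Setoid setoid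

  weight : ∀ {n} → List (Subset n) → Carrier
  weight []       = 0#
  weight (A ∷ As) = x ^ ∣ A ∣ + weight As

  weight-++ : ∀ {n} (As Bs : List (Subset n)) →
    weight (As ++ Bs) ≈ weight As + weight Bs
  weight-++ []       Bs = ≈-sym (+-identityˡ _)
  weight-++ (A ∷ As) Bs = ≈-trans (+-congˡ (weight-++ As Bs)) (≈-sym (+-assoc _ _ _))

  sum-indicator : ∀ (f : ℕ → Carrier) {a N} → a ℕ.< N →
    sum {N} (λ k → if does (a ℕ.≟ toℕ k) then f (toℕ k) else 0#) ≈ f a
  sum-indicator f {zero}  {suc N} _         =
    ≈-trans (+-congˡ (sum-replicate-zero N)) (+-identityʳ _)
  sum-indicator f {suc a} {suc N} (s≤s a<N) =
    ≈-trans (+-identityˡ _) (sum-indicator (f ∘ suc) a<N)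

  -- Double counting: prepending `A` raises only the count at index `∣ A ∣`, and the bound by `N`
  -- keeps that index inside the sum.
  sum-counts : ∀ {n N} {As : List (Subset n)} → All (λ A → ∣ A ∣ ≤ N) As →
    sum {suc N} (λ k → length (filter (λ A → ∣ A ∣ ℕ.≟ toℕ k) As) · x ^ toℕ k) ≈ weight As
  sum-counts {N = N} []                      = sum-replicate-zero (suc N)
  sum-counts {N = N} {A ∷ As} (∣A∣≤N ∷ bounds) = begin
    sum {suc N} (λ k → length (filter (λ B → ∣ B ∣ ℕ.≟ toℕ k) (A ∷ As)) · x ^ toℕ k)
      ≈⟨ sum-cong-≋ {suc N} (λ k → count-∷ (toℕ k)) ⟩
    sum {suc N} (λ k → indicator k + counts k)
      ≈⟨ ∑-distrib-+ {suc N} indicator counts ⟩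
    sum indicator + sum counts
      ≈⟨ +-cong (sum-indicator (x ^_) (s≤s ∣A∣≤N)) (sum-counts bounds) ⟩
    x ^ ∣ A ∣ + weight As ∎
    where
    indicator counts : Fin (suc N) → Carrier
    indicator k = if does (∣ A ∣ ℕ.≟ toℕ k) then x ^ toℕ k else 0#
    counts k = length (filter (λ B → ∣ B ∣ ℕ.≟ toℕ k) As) · x ^ toℕ k
    count-∷ : ∀ k → length (filter (λ B → ∣ B ∣ ℕ.≟ k) (A ∷ As)) · x ^ k ≈
      (if does (∣ A ∣ ℕ.≟ k) then x ^ k else 0#) +
      length (filter (λ B → ∣ B ∣ ℕ.≟ k) As) · x ^ k
    count-∷ k with does (∣ A ∣ ℕ.≟ k)
    ... | true  = ≈-refl
    ... | false = ≈-sym (+-identityˡ _)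

  genFun : ∀ {n} {P : Pred (Subset n) 0ℓ} → Decidable P → Carrier
  genFun {n} P? = weight (filter P? (subsets n))

  genFun-≐ : ∀ {n} {P Q : Pred (Subset n) 0ℓ} (P? : Decidable P) (Q? : Decidable Q) →
    P ≐ Q → genFun P? ≈ genFun Q?
  genFun-≐ {n} P? Q? P≐Q = reflexive (cong weight (filter-≐ P? Q? P≐Q (subsets n)))

  weight-outside : ∀ {n} {P : Pred (Subset (suc n)) 0ℓ} (P? : Decidable P) As →
    weight (filter P? (map (outside ∷_) As)) ≈ weight (filter (P? ∘ (outside ∷_)) As)
  weight-outside P? []       = ≈-refl
  weight-outside P? (A ∷ As) with does (P? (outside ∷ A))
  ... | true  = +-congˡ (weight-outside P? As)
  ... | false = weight-outside P? As

  weight-inside : ∀ {n} {P : Pred (Subset (suc n)) 0ℓ} (P? : Decidable P) As →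
    weight (filter P? (map (inside ∷_) As)) ≈ x * weight (filter (P? ∘ (inside ∷_)) As)
  weight-inside P? []       = ≈-sym (zeroʳ x)
  weight-inside P? (A ∷ As) with does (P? (inside ∷ A))
  ... | true  = ≈-trans (+-congˡ (weight-inside P? As)) (≈-sym (distribˡ x _ _))
  ... | false = weight-inside P? As

  -- Conditioning on the first vertex, which contributes a factor `x` when chosen. The inductions
  -- below run on this recursion.
  genFun-suc : ∀ {n} {P : Pred (Subset (suc n)) 0ℓ} (P? : Decidable P) →
    genFun P? ≈ genFun (P? ∘ (outside ∷_)) + x * genFun (P? ∘ (inside ∷_))
  genFun-suc {n} P? = begin
    weight (filter P? (outs ++ ins))
      ≡⟨ cong weight (filter-++ P? outs ins) ⟩
    weight (filter P? outs ++ filter P? ins)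
      ≈⟨ weight-++ (filter P? outs) (filter P? ins) ⟩
    weight (filter P? outs) + weight (filter P? ins)
      ≈⟨ +-cong (weight-outside P? (subsets n)) (weight-inside P? (subsets n)) ⟩
    genFun (P? ∘ (outside ∷_)) + x * genFun (P? ∘ (inside ∷_)) ∎
    where
    outs = map (outside ∷_) (subsets n)
    ins  = map (inside ∷_) (subsets n)

  genFun-all : ∀ {n} {P : Pred (Subset n) 0ℓ} (P? : Decidable P) →
    (∀ A → P A) → genFun P? ≈ (1# + x) ^ n
  genFun-all {zero} P? all with P? []
  ... | yes _ = +-identityʳ _
  ... | no ¬p = contradiction (all []) ¬p
  genFun-all {suc n} P? all = begin
    genFun P?
      ≈⟨ genFun-suc P? ⟩
    genFun (P? ∘ (outside ∷_)) + x * genFun (P? ∘ (inside ∷_))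
      ≈⟨ +-cong (genFun-all _ (λ A → all (outside ∷ A)))
                (*-congˡ (genFun-all _ (λ A → all (inside ∷ A)))) ⟩
    (1# + x) ^ n + x * (1# + x) ^ n
      ≈⟨ +-congʳ (*-identityˡ _) ⟨
    1# * (1# + x) ^ n + x * (1# + x) ^ n
      ≈⟨ distribʳ _ 1# x ⟨
    (1# + x) ^ suc n ∎

  genFun-none : ∀ {n} {P : Pred (Subset n) 0ℓ} (P? : Decidable P) →
    (∀ A → ¬ P A) → genFun P? ≈ 0#
  genFun-none {n} P? none =
    reflexive (cong weight (filter-none P? (universal none (subsets n))))

  genFun-suc-none : ∀ {n} {P : Pred (Subset (suc n)) 0ℓ} (P? : Decidable P) →
    (∀ A → ¬ P (inside ∷ A)) → genFun P? ≈ genFun (P? ∘ (outside ∷_))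
  genFun-suc-none P? none = begin
    genFun P?
      ≈⟨ genFun-suc P? ⟩
    genFun (P? ∘ (outside ∷_)) + x * genFun (P? ∘ (inside ∷_))
      ≈⟨ +-congˡ (*-congˡ (genFun-none (P? ∘ (inside ∷_)) none)) ⟩
    genFun (P? ∘ (outside ∷_)) + x * 0#
      ≈⟨ +-congˡ (zeroʳ x) ⟩
    genFun (P? ∘ (outside ∷_)) + 0#
      ≈⟨ +-identityʳ _ ⟩
    genFun (P? ∘ (outside ∷_)) ∎

  genFun-leftOnly : ∀ m n → genFun (leftOnly? m n) ≈ (1# + x) ^ m
  genFun-leftOnly zero zero    = +-identityʳ _
  genFun-leftOnly zero (suc n) = begin
    genFun (leftOnly? 0 (suc n))
      ≈⟨ genFun-suc-none (leftOnly? 0 (suc n)) (λ A left → contradiction (left zero here) λ ()) ⟩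
    genFun (leftOnly? 0 (suc n) ∘ (outside ∷_))
      ≈⟨ genFun-≐ _ (leftOnly? 0 n)
           ( (λ left v v∈A → left (suc v) (there v∈A))
           , λ { left (suc v) (there v∈A) → left v v∈A }) ⟩
    genFun (leftOnly? 0 n)
      ≈⟨ genFun-leftOnly zero n ⟩
    1# ∎
  genFun-leftOnly (suc m) n = begin
    genFun (leftOnly? (suc m) n)
      ≈⟨ genFun-suc (leftOnly? (suc m) n) ⟩
    genFun (leftOnly? (suc m) n ∘ (outside ∷_)) +
      x * genFun (leftOnly? (suc m) n ∘ (inside ∷_))
      ≈⟨ +-cong (step outside) (*-congˡ (step inside)) ⟩
    (1# + x) ^ m + x * (1# + x) ^ m
      ≈⟨ +-congʳ (*-identityˡ _) ⟨
    1# * (1# + x) ^ m + x * (1# + x) ^ m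
      ≈⟨ distribʳ _ 1# x ⟨
    (1# + x) ^ suc m ∎
    where
    step : ∀ s → genFun (leftOnly? (suc m) n ∘ (s ∷_)) ≈ (1# + x) ^ m
    step s = ≈-trans (genFun-≐ _ (leftOnly? m n) (leftOnly-∷ m n s)) (genFun-leftOnly m n)

  -- The 1 stands on the left because a semiring has no subtraction; `x+1≡y⇒x≡y-1` moves it later.
  -- In the induction, sets with the new left vertex add x(1+x)^m, which turns (1+x)^m into its
  -- successor power.
  genFun-independent : ∀ m n →
    genFun (independentᵇ? m n) + 1# ≈ (1# + x) ^ n + (1# + x) ^ m
  genFun-independent zero n =
    +-congʳ (genFun-all (independentᵇ? 0 n) λ A u v _ _ u~v → u~v refl)
  genFun-independent (suc m) n = begin
    genFun (independentᵇ? (suc m) n) + 1#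
      ≈⟨ +-congʳ (genFun-suc (independentᵇ? (suc m) n)) ⟩
    genFun (independentᵇ? (suc m) n ∘ (outside ∷_)) +
      x * genFun (independentᵇ? (suc m) n ∘ (inside ∷_)) + 1#
      ≈⟨ +-congʳ (+-cong
           (genFun-≐ _ (independentᵇ? m n) (independent-outside m n))
           (*-congˡ (≈-trans (genFun-≐ _ (leftOnly? m n) (independent-inside m n))
                             (genFun-leftOnly m n)))) ⟩
    genFun (independentᵇ? m n) + x * y + 1#
      ≈⟨ +-assoc _ _ _ ⟩
    genFun (independentᵇ? m n) + (x * y + 1#)
      ≈⟨ +-congˡ (+-comm _ _) ⟩
    genFun (independentᵇ? m n) + (1# + x * y)
      ≈⟨ +-assoc _ _ _ ⟨
    genFun (independentᵇ? m n) + 1# + x * y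
      ≈⟨ +-congʳ (genFun-independent m n) ⟩
    (1# + x) ^ n + y + x * y
      ≈⟨ +-assoc _ _ _ ⟩
    (1# + x) ^ n + (y + x * y)
      ≈⟨ +-congˡ (+-congʳ (*-identityˡ y)) ⟨
    (1# + x) ^ n + (1# * y + x * y)
      ≈⟨ +-congˡ (distribʳ y 1# x) ⟨
    (1# + x) ^ n + (1# + x) ^ suc m ∎
    where y = (1# + x) ^ m

  independencePolynomial-completeBipartite : ∀ m n → let G = completeBipartite m n in
    sum {suc (independenceNumber G)} (λ k → independentCount G (toℕ k) · x ^ toℕ k) + 1#
      ≈ (1# + x) ^ n + (1# + x) ^ m
  independencePolynomial-completeBipartite m n =
    -- `independenceNumber` is the maximum of the sizes, so cutting the sum off there loses no set.
    ≈-trans (+-congʳ (sum-counts (map⁻ (xs≤max 0 (map ∣_∣ (independentSets G))))))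
            (genFun-independent m n)
    where G = completeBipartite m n


-- Gaussian rationals as approximations of complex numbers.

-- Instantiated with ℚ this gives ℚ[i]; instantiated with the solver's polynomials it
-- gives solver expressions for the real and imaginary part of a complex polynomial.
pairRing : RawRing 0ℓ 0ℓ → RawRing 0ℓ 0ℓ
pairRing R = record
  { Carrier = Carrier × Carrier
  ; _≈_     = _≡_
  ; _+_     = λ (a , b) (c , d) → a + c , b + d
  ; _*_     = λ (a , b) (c , d) → a * c + (- (b * d)) , a * d + b * c
  ; -_      = λ (a , b) → - a , - b
  ; 0#      = 0# , 0#
  ; 1#      = 1# , 0#
  }
  where open RawRing R

ℚ[i]-rawRing : RawRing 0ℓ 0ℓ
ℚ[i]-rawRing = pairRing (CommutativeRing.rawRing ℚ.+-*-commutativeRing)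

module ℚ[i] where
  open RawRing ℚ[i]-rawRing public hiding (_≈_)
  open RawSemiringDefs rawSemiring public using (sum; _^_) renaming (_×_ to _·_)

ℚ[i]-isCommutativeSemiring : IsCommutativeSemiring _≡_ ℚ[i]._+_ ℚ[i]._*_ ℚ[i].0# ℚ[i].1#
ℚ[i]-isCommutativeSemiring = isCommutativeSemiringˡ record
  { +-isCommutativeMonoid = record
    { isMonoid = record
      { isSemigroup = record
        { isMagma = record { isEquivalence = isEquivalence ; ∙-cong = cong₂ ℚ[i]._+_ }
        ; assoc   = λ (a , b) (c , d) (e , f) → cong₂ _,_ (ℚ.+-assoc a c e) (ℚ.+-assoc b d f)
        }
      ; identity = (λ _ → cong₂ _,_ (ℚ.+-identityˡ _) (ℚ.+-identityˡ _))
                 , (λ _ → cong₂ _,_ (ℚ.+-identityʳ _) (ℚ.+-identityʳ _))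
      }
    ; comm = λ (a , b) (c , d) → cong₂ _,_ (ℚ.+-comm a c) (ℚ.+-comm b d)
    }
  ; *-isCommutativeMonoid = record
    { isMonoid = record
      { isSemigroup = record
        { isMagma = record { isEquivalence = isEquivalence ; ∙-cong = cong₂ ℚ[i]._*_ }
        ; assoc   = λ (a , b) (c , d) (e , f) → cong₂ _,_
            (solve 6 (λ a b c d e f →
              (a :* c :- b :* d) :* e :- (a :* d :+ b :* c) :* f :=
              a :* (c :* e :- d :* f) :- b :* (c :* f :+ d :* e)) refl a b c d e f)
            (solve 6 (λ a b c d e f →
              (a :* c :- b :* d) :* f :+ (a :* d :+ b :* c) :* e :=
              a :* (c :* f :+ d :* e) :+ b :* (c :* e :- d :* f)) refl a b c d e f)
        }
      ; identity = (λ (a , b) → cong₂ _,_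
            (solve 2 (λ a b → con 1ℚ :* a :- con 0ℚ :* b := a) refl a b)
            (solve 2 (λ a b → con 1ℚ :* b :+ con 0ℚ :* a := b) refl a b))
                 , (λ (a , b) → cong₂ _,_
            (solve 2 (λ a b → a :* con 1ℚ :- b :* con 0ℚ := a) refl a b)
            (solve 2 (λ a b → a :* con 0ℚ :+ b :* con 1ℚ := b) refl a b))
      }
    ; comm = λ (a , b) (c , d) → cong₂ _,_
        (solve 4 (λ a b c d → a :* c :- b :* d := c :* a :- d :* b) refl a b c d)
        (solve 4 (λ a b c d → a :* d :+ b :* c := c :* b :+ d :* a) refl a b c d)
    }
  ; distribʳ = λ (a , b) (c , d) (e , f) → cong₂ _,_
      (solve 6 (λ a b c d e f →
        (c :+ e) :* a :- (d :+ f) :* b := (c :* a :- d :* b) :+ (e :* a :- f :* b)) refl a b c d e f)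
      (solve 6 (λ a b c d e f →
        (c :+ e) :* b :+ (d :+ f) :* a := (c :* b :+ d :* a) :+ (e :* b :+ f :* a)) refl a b c d e f)
  ; zeroˡ = λ (a , b) → cong₂ _,_
      (solve 2 (λ a b → con 0ℚ :* a :- con 0ℚ :* b := con 0ℚ) refl a b)
      (solve 2 (λ a b → con 0ℚ :* b :+ con 0ℚ :* a := con 0ℚ) refl a b)
  }
  where open +-*-Solver

ℚ[i]-semiring : Semiring 0ℓ 0ℓ
ℚ[i]-semiring = record { isSemiring = IsCommutativeSemiring.isSemiring ℚ[i]-isCommutativeSemiring }

-- Operations on Cauchy sequences are termwise, so `at j` commutes with the ring operations by
-- computation. Identities can thus be proved in ℚ[i] with `_≡_`.
at : ℕ → ℂ → ℚ[i].Carrier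
at j z = seq (Re z) j , seq (Im z) j

at-^ : ∀ j z n → at j (z ℂ-Raw.^ n) ≡ at j z ℚ[i].^ n
at-^ j z zero    = refl
at-^ j z (suc n) = cong (at j z ℚ[i].*_) (at-^ j z n)

at-· : ∀ j n z → at j (n ℂ-Raw.· z) ≡ n ℚ[i].· at j z
at-· j zero    z = refl
at-· j (suc n) z = cong (at j z ℚ[i].+_) (at-· j n z)

at-sum : ∀ j {n} (f : Fin n → ℂ) → at j (ℂ-Raw.sum f) ≡ ℚ[i].sum (at j ∘ f)
at-sum j {zero}  f = refl
at-sum j {suc n} f = cong (at j (f zero) ℚ[i].+_) (at-sum j (f ∘ suc))

sum-cong : ∀ {n} {f g : Fin n → ℚ[i].Carrier} → (∀ k → f k ≡ g k) → ℚ[i].sum f ≡ ℚ[i].sum g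
sum-cong {zero}  f≗g = refl
sum-cong {suc n} f≗g = cong₂ ℚ[i]._+_ (f≗g zero) (sum-cong (f≗g ∘ suc))

independencePolynomialℚ : ∀ {n} → SimpleGraph n → ℚ[i].Carrier → ℚ[i].Carrier
independencePolynomialℚ G z =
  ℚ[i].sum {suc (independenceNumber G)} λ k → independentCount G (toℕ k) ℚ[i].· (z ℚ[i].^ toℕ k)

at-independencePolynomial : ∀ j {n} (G : SimpleGraph n) z →
  at j (independencePolynomial G z) ≡ independencePolynomialℚ G (at j z)
at-independencePolynomial j G z = trans
  (at-sum j {suc (independenceNumber G)} λ k → independentCount G (toℕ k) ℂ-Raw.· (z ℂ-Raw.^ toℕ k))
  (sum-cong {suc (independenceNumber G)} λ k → trans
    (at-· j (independentCount G (toℕ k)) (z ℂ-Raw.^ toℕ k))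
    (cong (independentCount G (toℕ k) ℚ[i].·_) (at-^ j z (toℕ k))))

-- A raw ring suffices as parameter, so the formulas can be evaluated over ℂ, over ℚ[i] and on
-- solver expressions.
module _ (R : RawRing 0ℓ 0ℓ) where
  open RawRing R
  open RawSemiringDefs rawSemiring using (_^_)

  bipartitePolynomial : (m n : ℕ) → Carrier → Carrier
  bipartitePolynomial m n z = ((1# + z) ^ n + (1# + z) ^ m) + (- 1#)

  -- This is `bipartitePolynomial` with the sign of w^m - 1 reversed, where w = 1 + z.
  reflected : (m n : ℕ) → Carrier → Carrier
  reflected m n z = ((1# + z) ^ n + (- ((1# + z) ^ m))) + 1#

  power-1 : ℕ → Carrier → Carrier
  power-1 m z = (1# + z) ^ m + (- 1#)

  cubic : (l a b z : Carrier) → Carrier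
  cubic l a b z = ((l * z + a) * z + b) * z + 1#

  evenPart : (a z : Carrier) → Carrier
  evenPart a z = a * (z * z) + 1#

  oddPart : (a b z : Carrier) → Carrier
  oddPart a b z = a * (z * (z * z)) + b * z

x+1≡y⇒x≡y-1 : ∀ z w → z ℚ[i].+ ℚ[i].1# ≡ w → z ≡ w ℚ[i].+ (ℚ[i].- ℚ[i].1#)
x+1≡y⇒x≡y-1 (a , b) _ refl = cong₂ _,_
  (solve 1 (λ a → a := a :+ con 1ℚ :+ (:- con 1ℚ)) refl a)
  (solve 1 (λ b → b := b :+ con 0ℚ :+ (:- con 0ℚ)) refl b)
  where open +-*-Solver

independencePolynomialℚ-completeBipartite : ∀ m n z →
  independencePolynomialℚ (completeBipartite m n) z ≡ bipartitePolynomial ℚ[i]-rawRing m n z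
independencePolynomialℚ-completeBipartite m n z = x+1≡y⇒x≡y-1
  (independencePolynomialℚ (completeBipartite m n) z)
  ((ℚ[i].1# ℚ[i].+ z) ℚ[i].^ n ℚ[i].+ (ℚ[i].1# ℚ[i].+ z) ℚ[i].^ m)
  (independencePolynomial-completeBipartite ℚ[i]-semiring z m n)

at-completeBipartite : ∀ j m n z →
  at j (independencePolynomial (completeBipartite m n) z) ≡
  bipartitePolynomial ℚ[i]-rawRing m n (at j z)
at-completeBipartite j m n z = begin
  at j (independencePolynomial (completeBipartite m n) z)
    ≡⟨ at-independencePolynomial j (completeBipartite m n) z ⟩
  independencePolynomialℚ (completeBipartite m n) (at j z)
    ≡⟨ independencePolynomialℚ-completeBipartite m n (at j z) ⟩
  bipartitePolynomial ℚ[i]-rawRing m n (at j z) ∎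
  where open ≡-Reasoning

-- From a multiplier to stability.

-- z ∙ w is the real part of z · conj w.
infix 7 _∙_
_∙_ : ℚ[i].Carrier → ℚ[i].Carrier → ℚ
(a , b) ∙ (c , d) = a ℚ.* c ℚ.+ b ℚ.* d

∣p∣<ε⇒p<ε : ∀ {p ε} → ℚ.∣ p ∣ ℚ.< ε → p ℚ.< ε
∣p∣<ε⇒p<ε {p} = ℚ.≤-<-trans (p≤∣p∣ p)
  where
  p≤∣p∣ : ∀ p → p ℚ.≤ ℚ.∣ p ∣
  p≤∣p∣ p with ℚ.≤-total 0ℚ p
  ... | inj₁ 0≤p = ℚ.≤-reflexive (sym (ℚ.0≤p⇒∣p∣≡p 0≤p))
  ... | inj₂ p≤0 = ℚ.≤-trans p≤0 (ℚ.0≤∣p∣ p)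

-- A null sequence times a bounded one: the parts of `q` are bounded because they are Cauchy. The
-- choice Aδ + Bδ = ε gives one summand to the real parts and one to the imaginary parts.
root⇒∙-null : ∀ p q → p ℂ-Raw.≈ ℂ-Raw.0# →
  ∀ ε → 0ℚ ℚ.< ε → Eventually λ j → at j p ∙ at j q ℚ.< ε
root⇒∙-null p q (Re-p≈0 , Im-p≈0) ε 0<ε =
  let A , 0<A , K , boundᴿ = cauchy⇒bounded {seq (Re q)} (cauchy (Re q))
      B , 0<B , L , boundᴵ = cauchy⇒bounded {seq (Im q)} (cauchy (Im q))
      δ , 0<δ , total      = split-ε 0<A 0<B 0<ε
      M , h = Re-p≈0 δ 0<δ
      N , k = Im-p≈0 δ 0<δ
  in (K ⊔ L) ⊔ (M ⊔ N) , λ j p≤j →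
    let pl = ℕ.m⊔n≤o⇒m≤o (K ⊔ L) (M ⊔ N) p≤j
        pr = ℕ.m⊔n≤o⇒n≤o (K ⊔ L) (M ⊔ N) p≤j
    in subst (at j p ∙ at j q ℚ.<_) total (ℚ.+-mono-<
         (product-< (seq (Re p) j) 0<A (boundᴿ j (ℕ.m⊔n≤o⇒m≤o K L pl)) (h j (ℕ.m⊔n≤o⇒m≤o M N pr)))
         (product-< (seq (Im p) j) 0<B (boundᴵ j (ℕ.m⊔n≤o⇒n≤o K L pl)) (k j (ℕ.m⊔n≤o⇒n≤o M N pr))))
  where
  product-< : ∀ {C δ} a {b} → 0ℚ ℚ.< C → ℚ.∣ b ∣ ℚ.< C → ℚ.∣ a ℚ.- 0ℚ ∣ ℚ.< δ →
    a ℚ.* b ℚ.< C ℚ.* δ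
  product-< {C} {δ} a {b} 0<C b<C a<δ = ∣p∣<ε⇒p<ε
    (subst (λ c → ℚ.∣ c ∣ ℚ.< C ℚ.* δ) (ℚ.*-comm b a)
      (∣p*q∣<B*δ {b} {a} 0<C b<C
        (subst (λ c → ℚ.∣ c ∣ ℚ.< δ) (ℚ.+-identityʳ a) a<δ)))

-- Order is decidable on ℚ, so the case split on the sign is made at each approximation of Re z: a
-- nonpositive one is below ε at once, a positive one is bounded by the null product.
root⇒Re≤0 : ∀ z p q →
  (∀ j → 0ℚ ℚ.< seq (Re z) j → seq (Re z) j ℚ.≤ at j p ∙ at j q) →
  p ℂ-Raw.≈ ℂ-Raw.0# → Re z ≤ᴿ 0ᴿ
root⇒Re≤0 z p q positive p≈0 ε 0<ε =
  let N , small = root⇒∙-null p q p≈0 ε 0<ε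
  in N , λ j N≤j → subst (seq (Re z) j ℚ.<_) (sym (ℚ.+-identityˡ ε)) (bound j (small j N≤j))
  where
  bound : ∀ j → at j p ∙ at j q ℚ.< ε → seq (Re z) j ℚ.< ε
  bound j small with 0ℚ ℚ.<? seq (Re z) j
  ... | yes 0<x = ℚ.≤-<-trans (positive j 0<x) small
  ... | no  x≯0 = ℚ.≤-<-trans (ℚ.≮⇒≥ x≯0) 0<ε

-- `q` and `q′` are the same multiplier over ℂ and over ℚ[i]. What remains to be shown is an
-- inequality between rationals.
stable-by-multiplier : ∀ m n (q : ℂ → ℂ) (q′ : ℚ[i].Carrier → ℚ[i].Carrier) →
  (∀ j z → at j (q z) ≡ q′ (at j z)) →
  (∀ z → 0ℚ ℚ.< proj₁ z → proj₁ z ℚ.≤ bipartitePolynomial ℚ[i]-rawRing m n z ∙ q′ z) →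
  Stable (completeBipartite m n)
stable-by-multiplier m n q q′ at-q positive z =
  root⇒Re≤0 z (independencePolynomial (completeBipartite m n) z) (q z) λ j 0<x →
    subst (seq (Re z) j ℚ.≤_)
      (sym (cong₂ _∙_ (at-completeBipartite j m n z) (at-q j z)))
      (positive (at j z) 0<x)

-- Nonnegativity certificates over ℚ.

polynomialRing : ℕ → RawRing 0ℓ 0ℓ
polynomialRing n = record
  { Carrier = Polynomial n
  ; _≈_     = _≡_
  ; _+_     = _:+_
  ; _*_     = _:*_
  ; -_      = :-_
  ; 0#      = con 0ℚ
  ; 1#      = con 1ℚ
  }
  where open +-*-Solver

0≤+ : ∀ {p q} → 0ℚ ℚ.≤ p → 0ℚ ℚ.≤ q → 0ℚ ℚ.≤ p ℚ.+ q
0≤+ = ℚ.+-mono-≤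

0≤* : ∀ {p q} → 0ℚ ℚ.≤ p → 0ℚ ℚ.≤ q → 0ℚ ℚ.≤ p ℚ.* q
0≤* {p} {q} 0≤p 0≤q = ℚ.nonNegative⁻¹ (p ℚ.* q)
  {{ℚ.nonNeg*nonNeg⇒nonNeg p {{ℚ.nonNegative 0≤p}} q {{ℚ.nonNegative 0≤q}}}}

0≤sq : ∀ p → 0ℚ ℚ.≤ p ℚ.* p
0≤sq p with ℚ.≤-total 0ℚ p
... | inj₁ 0≤p = 0≤* 0≤p 0≤p
... | inj₂ p≤0 = subst (0ℚ ℚ.≤_) (solve 1 (λ p → (:- p) :* (:- p) := p :* p) refl p)
  (0≤* (ℚ.neg-antimono-≤ p≤0) (ℚ.neg-antimono-≤ p≤0))
  where open +-*-Solver

≤-difference : ∀ {p q d} → 0ℚ ℚ.≤ d → q ≡ d ℚ.+ p → p ℚ.≤ q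
≤-difference {p} {_} {d} 0≤d refl =
  subst (ℚ._≤ d ℚ.+ p) (ℚ.+-identityˡ p) (ℚ.+-monoˡ-≤ p 0≤d)

p≤q⇒0≤q-p : ∀ {p q} → p ℚ.≤ q → 0ℚ ℚ.≤ q ℚ.- p
p≤q⇒0≤q-p {p} {q} p≤q = subst (ℚ._≤ q ℚ.- p) (ℚ.+-inverseʳ p) (ℚ.+-monoˡ-≤ (ℚ.- p) p≤q)

-- Small cases by even and odd parts.

-- With p = even + odd, Re (p · conj even) = |even|² + Re (odd · conj even), and
-- the last term is Re z times a polynomial that is positive when 3l ≤ ab.
-- Quadratics are covered by l = 0.
cubic-bound : ∀ l a b → 0ℚ ℚ.≤ l → 0ℚ ℚ.≤ a → 1ℚ ℚ.≤ b → + 3 / 1 ℚ.* l ℚ.≤ a ℚ.* b →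
  ∀ z → 0ℚ ℚ.< proj₁ z →
  proj₁ z ℚ.≤ cubic ℚ[i]-rawRing (l , 0ℚ) (a , 0ℚ) (b , 0ℚ) z ∙ evenPart ℚ[i]-rawRing (a , 0ℚ) z
cubic-bound l a b 0≤l 0≤a 1≤b 3l≤ab z@(x , y) 0<x =
  ≤-difference
    (0≤+ (0≤+ (0≤sq (proj₁ e)) (0≤sq (proj₂ e)))
         (0≤* 0≤x (0≤+ (0≤+ (0≤+ (0≤* (0≤* 0≤l 0≤a) (0≤* 0≤r 0≤r)) (0≤* (p≤q⇒0≤q-p 3l≤ab) 0≤r))
                            (0≤* (0≤* (ℚ.nonNegative⁻¹ (+ 4 / 1)) 0≤l) (0≤sq x)))
                       (p≤q⇒0≤q-p 1≤b))))
    -- With r = |z|², the identity Re z³ = 4x³ - 3xr produces both the term 4lx² and the -3l in the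
    -- coefficient of r. Splitting b as (b - 1) + 1 leaves the final x as the lower bound.
    (solve 5 (λ l a b x y →
        let e₁ , e₂ = evenPart (pairRing (polynomialRing 5)) (a , con 0ℚ) (x , y)
            p₁ , p₂ = cubic (pairRing (polynomialRing 5)) (l , con 0ℚ) (a , con 0ℚ) (b , con 0ℚ) (x , y)
            r = x :* x :+ y :* y
        in p₁ :* e₁ :+ p₂ :* e₂ :=
           e₁ :* e₁ :+ e₂ :* e₂ :+
           x :* (l :* a :* (r :* r) :+ (a :* b :- con (+ 3 / 1) :* l) :* r :+
                 con (+ 4 / 1) :* l :* (x :* x) :+ (b :- con 1ℚ)) :+ x)
      refl l a b x y)
  where
  open +-*-Solver
  e = evenPart ℚ[i]-rawRing (a , 0ℚ) z
  0≤x = ℚ.<⇒≤ 0<x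
  0≤r = 0≤+ (0≤sq x) (0≤sq y)

-- The coefficients are closed rationals in every use, so the implicit arguments are filled by
-- evaluating the decision procedures.
stable-cubic : ∀ m n l a b
  {0≤l : True (0ℚ ℚ.≤? l)} {0≤a : True (0ℚ ℚ.≤? a)} {1≤b : True (1ℚ ℚ.≤? b)}
  {3l≤ab : True (+ 3 / 1 ℚ.* l ℚ.≤? a ℚ.* b)} →
  (∀ z → bipartitePolynomial ℚ[i]-rawRing m n z ≡
         cubic ℚ[i]-rawRing (l , 0ℚ) (a , 0ℚ) (b , 0ℚ) z) →
  Stable (completeBipartite m n)
stable-cubic m n l a b {0≤l} {0≤a} {1≤b} {3l≤ab} eq = stable-by-multiplier m n
  (evenPart ℂ-rawRing (fromℚ a +i 0ᴿ)) (evenPart ℚ[i]-rawRing (a , 0ℚ)) (λ _ _ → refl)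
  λ z 0<x → subst (λ p → proj₁ z ℚ.≤ p ∙ evenPart ℚ[i]-rawRing (a , 0ℚ) z) (sym (eq z))
    (cubic-bound l a b (toWitness 0≤l) (toWitness 0≤a) (toWitness 1≤b) (toWitness 3l≤ab) z 0<x)

private
  open +-*-Solver

  bipartite : ℕ → ℕ → (x y : Polynomial 2) → Polynomial 2 × Polynomial 2
  bipartite m n x y = bipartitePolynomial (pairRing (polynomialRing 2)) m n (x , y)

  cubicᴾ : (l a b : ℚ) (x y : Polynomial 2) → Polynomial 2 × Polynomial 2
  cubicᴾ l a b x y =
    cubic (pairRing (polynomialRing 2)) (con l , con 0ℚ) (con a , con 0ℚ) (con b , con 0ℚ) (x , y)

-- Here and in the next four cases l, a, b are the coefficients of z³, z², z in the expansion of P,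
-- whose constant term is 1.
stable-2-1 : Stable (completeBipartite 2 1)
stable-2-1 = stable-cubic 2 1 (+ 0 / 1) (+ 1 / 1) (+ 3 / 1) λ (x , y) → cong₂ _,_
  (solve 2 (λ x y → proj₁ (bipartite 2 1 x y) :=
    proj₁ (cubicᴾ (+ 0 / 1) (+ 1 / 1) (+ 3 / 1) x y)) refl x y)
  (solve 2 (λ x y → proj₂ (bipartite 2 1 x y) :=
    proj₂ (cubicᴾ (+ 0 / 1) (+ 1 / 1) (+ 3 / 1) x y)) refl x y)

stable-2-2 : Stable (completeBipartite 2 2)
stable-2-2 = stable-cubic 2 2 (+ 0 / 1) (+ 2 / 1) (+ 4 / 1) λ (x , y) → cong₂ _,_
  (solve 2 (λ x y → proj₁ (bipartite 2 2 x y) :=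
    proj₁ (cubicᴾ (+ 0 / 1) (+ 2 / 1) (+ 4 / 1) x y)) refl x y)
  (solve 2 (λ x y → proj₂ (bipartite 2 2 x y) :=
    proj₂ (cubicᴾ (+ 0 / 1) (+ 2 / 1) (+ 4 / 1) x y)) refl x y)

stable-3-1 : Stable (completeBipartite 3 1)
stable-3-1 = stable-cubic 3 1 (+ 1 / 1) (+ 3 / 1) (+ 4 / 1) λ (x , y) → cong₂ _,_
  (solve 2 (λ x y → proj₁ (bipartite 3 1 x y) :=
    proj₁ (cubicᴾ (+ 1 / 1) (+ 3 / 1) (+ 4 / 1) x y)) refl x y)
  (solve 2 (λ x y → proj₂ (bipartite 3 1 x y) :=
    proj₂ (cubicᴾ (+ 1 / 1) (+ 3 / 1) (+ 4 / 1) x y)) refl x y)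

stable-3-2 : Stable (completeBipartite 3 2)
stable-3-2 = stable-cubic 3 2 (+ 1 / 1) (+ 4 / 1) (+ 5 / 1) λ (x , y) → cong₂ _,_
  (solve 2 (λ x y → proj₁ (bipartite 3 2 x y) :=
    proj₁ (cubicᴾ (+ 1 / 1) (+ 4 / 1) (+ 5 / 1) x y)) refl x y)
  (solve 2 (λ x y → proj₂ (bipartite 3 2 x y) :=
    proj₂ (cubicᴾ (+ 1 / 1) (+ 4 / 1) (+ 5 / 1) x y)) refl x y)

stable-3-3 : Stable (completeBipartite 3 3)
stable-3-3 = stable-cubic 3 3 (+ 2 / 1) (+ 6 / 1) (+ 6 / 1) λ (x , y) → cong₂ _,_
  (solve 2 (λ x y → proj₁ (bipartite 3 3 x y) :=
    proj₁ (cubicᴾ (+ 2 / 1) (+ 6 / 1) (+ 6 / 1) x y)) refl x y)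
  (solve 2 (λ x y → proj₂ (bipartite 3 3 x y) :=
    proj₂ (cubicᴾ (+ 2 / 1) (+ 6 / 1) (+ 6 / 1) x y)) refl x y)

-- P = z⁴ + 5z³ + 9z² + 7z + 1.
stable-3-4 : Stable (completeBipartite 3 4)
stable-3-4 = stable-by-multiplier 3 4
  (oddPart ℂ-rawRing (fromℚ (+ 5 / 1) +i 0ᴿ) (fromℚ (+ 7 / 1) +i 0ᴿ)) odd (λ _ _ → refl) bound
  where
  open +-*-Solver
  odd : ℚ[i].Carrier → ℚ[i].Carrier
  odd = oddPart ℚ[i]-rawRing (+ 5 / 1 , 0ℚ) (+ 7 / 1 , 0ℚ)
  bound : ∀ z → 0ℚ ℚ.< proj₁ z →
    proj₁ z ℚ.≤ bipartitePolynomial ℚ[i]-rawRing 3 4 z ∙ odd z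
  bound z@(x , y) 0<x = ≤-difference
    -- Besides |odd|² there is Re (even · conj odd) with even = z⁴ + 9z² + 1. Re z³ = 4x³ - 3xr
    -- gives 24 = 45 - 21 and 48 = 63 - 15, and 7 = 6 + 1 leaves the final x.
    (0≤+ (0≤+ (0≤sq (proj₁ (odd z))) (0≤sq (proj₂ (odd z))))
         (0≤* 0≤x (0≤+ (0≤+ (0≤+ (0≤+ (0≤+
           (0≤* (ℚ.nonNegative⁻¹ (+ 5 / 1)) (0≤* 0≤r (0≤sq r)))
           (0≤* (ℚ.nonNegative⁻¹ (+ 24 / 1)) (0≤sq r)))
           (0≤* (ℚ.nonNegative⁻¹ (+ 48 / 1)) 0≤r))
           (0≤* (ℚ.nonNegative⁻¹ (+ 28 / 1)) (0≤* 0≤r (0≤sq x))))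
           (0≤* (ℚ.nonNegative⁻¹ (+ 20 / 1)) (0≤sq x)))
           (ℚ.nonNegative⁻¹ (+ 6 / 1)))))
    (solve 2 (λ x y →
        let p₁ , p₂ = bipartitePolynomial (pairRing (polynomialRing 2)) 3 4 (x , y)
            o₁ , o₂ = oddPart (pairRing (polynomialRing 2))
                        (con (+ 5 / 1) , con 0ℚ) (con (+ 7 / 1) , con 0ℚ) (x , y)
            r = x :* x :+ y :* y
        in p₁ :* o₁ :+ p₂ :* o₂ :=
           o₁ :* o₁ :+ o₂ :* o₂ :+
           x :* (con (+ 5 / 1) :* (r :* (r :* r)) :+ con (+ 24 / 1) :* (r :* r) :+
                 con (+ 48 / 1) :* r :+ con (+ 28 / 1) :* (r :* (x :* x)) :+
                 con (+ 20 / 1) :* (x :* x) :+ con (+ 6 / 1)) :+ x)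
      refl x y)
    where
    r = x ℚ.* x ℚ.+ y ℚ.* y
    0≤x = ℚ.<⇒≤ 0<x
    0≤r = 0≤+ (0≤sq x) (0≤sq y)

-- Large n by comparison of moduli.

open RawSemiringDefs (RawRing.rawSemiring (CommutativeRing.rawRing ℚ.+-*-commutativeRing))
  using (_^_)

-- The norm is multiplicative by the two-square identity of Brahmagupta and Fibonacci.
∙-^ : ∀ w n → (w ℚ[i].^ n) ∙ (w ℚ[i].^ n) ≡ (w ∙ w) ^ n
∙-^ w zero = refl
∙-^ w@(a , b) (suc n) = trans (∙-* w (w ℚ[i].^ n)) (cong ((w ∙ w) ℚ.*_) (∙-^ w n))
  where
  open +-*-Solver
  ∙-* : ∀ z w → (z ℚ[i].* w) ∙ (z ℚ[i].* w) ≡ (z ∙ z) ℚ.* (w ∙ w)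
  ∙-* (a , b) (c , d) = solve 4 (λ a b c d →
    (a :* c :+ (:- (b :* d))) :* (a :* c :+ (:- (b :* d))) :+
    (a :* d :+ b :* c) :* (a :* d :+ b :* c) :=
    (a :* a :+ b :* b) :* (c :* c :+ d :* d)) refl a b c d

p≤p*q : ∀ {p q} → 1ℚ ℚ.≤ p → 1ℚ ℚ.≤ q → p ℚ.≤ p ℚ.* q
p≤p*q {p} {q} 1≤p 1≤q = subst (ℚ._≤ p ℚ.* q) (ℚ.*-identityʳ p)
  (ℚ.*-monoˡ-≤-nonNeg p {{ℚ.nonNegative (ℚ.≤-trans (ℚ.nonNegative⁻¹ 1ℚ) 1≤p)}} 1≤q)

1≤p^n : ∀ {p} n → 1ℚ ℚ.≤ p → 1ℚ ℚ.≤ p ^ n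
1≤p^n zero    1≤p = ℚ.≤-refl
1≤p^n (suc n) 1≤p = ℚ.≤-trans 1≤p (p≤p*q 1≤p (1≤p^n n 1≤p))

^-monoʳ-≤ : ∀ {p k n} → 1ℚ ℚ.≤ p → k ≤ n → p ^ k ℚ.≤ p ^ n
^-monoʳ-≤ {p} {n = n} 1≤p z≤n       = 1≤p^n n 1≤p
^-monoʳ-≤ {p}         1≤p (s≤s k≤n) =
  ℚ.*-monoˡ-≤-nonNeg p {{ℚ.nonNegative (ℚ.≤-trans (ℚ.nonNegative⁻¹ 1ℚ) 1≤p)}} (^-monoʳ-≤ 1≤p k≤n)

-- Keeping s = |1+z|² − 1 ≥ 0 as a variable of its own makes both of the estimates
-- below sums of squares and products of nonnegative terms.
∣1+z∣²-1 : ℚ[i].Carrier → ℚ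
∣1+z∣²-1 (x , y) = + 2 / 1 ℚ.* x ℚ.+ x ℚ.* x ℚ.+ y ℚ.* y

0≤∣1+z∣²-1 : ∀ z → 0ℚ ℚ.≤ proj₁ z → 0ℚ ℚ.≤ ∣1+z∣²-1 z
0≤∣1+z∣²-1 (x , y) 0≤x = 0≤+ (0≤+ (0≤* (ℚ.nonNegative⁻¹ (+ 2 / 1)) 0≤x) (0≤sq x)) (0≤sq y)

1≤∣1+z∣² : ∀ z → 0ℚ ℚ.< proj₁ z → 1ℚ ℚ.≤ (ℚ[i].1# ℚ[i].+ z) ∙ (ℚ[i].1# ℚ[i].+ z)
1≤∣1+z∣² z@(x , y) 0<x = ≤-difference (0≤∣1+z∣²-1 z (ℚ.<⇒≤ 0<x))
  (solve 2 (λ x y →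
    (con 1ℚ :+ x) :* (con 1ℚ :+ x) :+ (con 0ℚ :+ y) :* (con 0ℚ :+ y) :=
    con (+ 2 / 1) :* x :+ x :* x :+ y :* y :+ con 1ℚ) refl x y)
  where open +-*-Solver

-- Since |w| ≥ 1 on the right half-plane, |w|^(2n) grows with n, so the estimate at the smallest
-- exponent `k` serves all larger ones.
stable-by-modulus : ∀ m {k n} → k ≤ n →
  (∀ z → 0ℚ ℚ.< proj₁ z → proj₁ z ℚ.≤
    ((ℚ[i].1# ℚ[i].+ z) ∙ (ℚ[i].1# ℚ[i].+ z)) ^ k ℚ.-
    power-1 ℚ[i]-rawRing m z ∙ power-1 ℚ[i]-rawRing m z) →
  Stable (completeBipartite m n)
stable-by-modulus m {k} {n} k≤n bound = stable-by-multiplier m n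
  (reflected ℂ-rawRing m n) (reflected ℚ[i]-rawRing m n) at-reflected λ z 0<x →
  let w = ℚ[i].1# ℚ[i].+ z ; e = power-1 ℚ[i]-rawRing m z in begin
    proj₁ z
      ≤⟨ bound z 0<x ⟩
    (w ∙ w) ^ k ℚ.- e ∙ e
      ≤⟨ ℚ.+-monoˡ-≤ _ (^-monoʳ-≤ (1≤∣1+z∣² z 0<x) k≤n) ⟩
    (w ∙ w) ^ n ℚ.- e ∙ e
      ≡⟨ cong (ℚ._- e ∙ e) (∙-^ w n) ⟨
    (w ℚ[i].^ n) ∙ (w ℚ[i].^ n) ℚ.- e ∙ e
      ≡⟨ difference-of-norms (w ℚ[i].^ n) (w ℚ[i].^ m) ⟨
    bipartitePolynomial ℚ[i]-rawRing m n z ∙ reflected ℚ[i]-rawRing m n z ∎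
  where
  open ℚ.≤-Reasoning
  open +-*-Solver
  at-reflected : ∀ j z → at j (reflected ℂ-rawRing m n z) ≡ reflected ℚ[i]-rawRing m n (at j z)
  at-reflected j z = cong₂ (λ u v → u ℚ[i].+ (ℚ[i].- v) ℚ[i].+ ℚ[i].1#)
    (at-^ j (ℂ-Raw.1# ℂ-Raw.+ z) n) (at-^ j (ℂ-Raw.1# ℂ-Raw.+ z) m)
  -- With e = v - 1 the factors are u + e and u - e. The cross terms u · conj e and e · conj u have
  -- equal real parts and cancel.
  difference-of-norms : ∀ u v →
    (u ℚ[i].+ v ℚ[i].+ (ℚ[i].- ℚ[i].1#)) ∙ (u ℚ[i].+ (ℚ[i].- v) ℚ[i].+ ℚ[i].1#) ≡
    u ∙ u ℚ.- (v ℚ[i].+ (ℚ[i].- ℚ[i].1#)) ∙ (v ℚ[i].+ (ℚ[i].- ℚ[i].1#))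
  difference-of-norms (a , b) (c , d) = solve 4 (λ a b c d →
    (a :+ c :+ (:- con 1ℚ)) :* (a :+ (:- c) :+ con 1ℚ) :+
    (b :+ d :+ (:- con 0ℚ)) :* (b :+ (:- d) :+ con 0ℚ) :=
    a :* a :+ b :* b :-
    ((c :+ (:- con 1ℚ)) :* (c :+ (:- con 1ℚ)) :+ (d :+ (:- con 0ℚ)) :* (d :+ (:- con 0ℚ))))
    refl a b c d

-- As |z|² = s - 2x and |z + 2|² = s + 2x + 4, the difference equals s³ + 2s² - s + 1 + 4x² + 8x.
-- The constant 1/4 completes the square in 2s² - s, and one x of the eight is the lower bound.
stable-2-large : ∀ {n} → 3 ≤ n → Stable (completeBipartite 2 n)
stable-2-large 3≤n = stable-by-modulus 2 3≤n λ z@(x , y) 0<x →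
  let 0≤x = ℚ.<⇒≤ 0<x
      s   = ∣1+z∣²-1 z
      0≤s = 0≤∣1+z∣²-1 z 0≤x in
  ≤-difference
    (0≤+ (0≤+ (0≤+ (0≤+ (0≤* 0≤s (0≤sq s))
      (0≤* (ℚ.nonNegative⁻¹ (+ 2 / 1)) (0≤sq (s ℚ.- + 1 / 4))))
      (ℚ.nonNegative⁻¹ (+ 7 / 8)))
      (0≤* (ℚ.nonNegative⁻¹ (+ 7 / 1)) 0≤x))
      (0≤* (ℚ.nonNegative⁻¹ (+ 4 / 1)) (0≤sq x)))
    (solve 2 (λ x y →
      let e₁ , e₂ = power-1 (pairRing (polynomialRing 2)) 2 (x , y)
          -- `a` and `b` are the parts of 1 + z. The `con 0ℚ` here and the `con 1ℚ` ending the power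
          -- below copy how the goal unfolds.
          a = con 1ℚ :+ x
          b = con 0ℚ :+ y
          r = a :* a :+ b :* b
          s = con (+ 2 / 1) :* x :+ x :* x :+ y :* y
          t = s :- con (+ 1 / 4)
      in r :* (r :* (r :* con 1ℚ)) :- (e₁ :* e₁ :+ e₂ :* e₂) :=
         s :* (s :* s) :+ con (+ 2 / 1) :* (t :* t) :+ con (+ 7 / 8) :+
         con (+ 7 / 1) :* x :+ con (+ 4 / 1) :* (x :* x) :+ x) refl x y)
  where
  open +-*-Solver

-- From |w³ - 1|² = |w|⁶ - 2 Re w³ + 1, the difference is s⁵ + 5s⁴ + 9s³ + 7s² - 4s + 1 + 8x³ + 24x²
-- - 6sx + 18x. The square with 1/8 absorbs -6sx, and (1 - 2s)² absorbs -4s. With exponent 4 the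
-- estimate fails near z = iy, y² = 1/2, where the difference is -5/16.
stable-3-large : ∀ {n} → 5 ≤ n → Stable (completeBipartite 3 n)
stable-3-large 5≤n = stable-by-modulus 3 5≤n λ z@(x , y) 0<x →
  let 0≤x = ℚ.<⇒≤ 0<x
      s   = ∣1+z∣²-1 z
      0≤s = 0≤∣1+z∣²-1 z 0≤x in
  ≤-difference
    (0≤+ (0≤+ (0≤+ (0≤+ (0≤+ (0≤+ (0≤+
      (0≤* (ℚ.nonNegative⁻¹ (+ 24 / 1)) (0≤sq (x ℚ.- + 1 / 8 ℚ.* s)))
      (0≤* (ℚ.nonNegative⁻¹ (+ 21 / 8)) (0≤sq s)))
      (0≤sq (1ℚ ℚ.- + 2 / 1 ℚ.* s)))
      (0≤* (ℚ.nonNegative⁻¹ (+ 9 / 1)) (0≤* 0≤s (0≤sq s))))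
      (0≤* (ℚ.nonNegative⁻¹ (+ 5 / 1)) (0≤* (0≤sq s) (0≤sq s))))
      (0≤* 0≤s (0≤* (0≤sq s) (0≤sq s))))
      (0≤* (ℚ.nonNegative⁻¹ (+ 8 / 1)) (0≤* 0≤x (0≤sq x))))
      (0≤* (ℚ.nonNegative⁻¹ (+ 17 / 1)) 0≤x))
    (solve 2 (λ x y →
      let e₁ , e₂ = power-1 (pairRing (polynomialRing 2)) 3 (x , y)
          a = con 1ℚ :+ x
          b = con 0ℚ :+ y
          r = a :* a :+ b :* b
          s = con (+ 2 / 1) :* x :+ x :* x :+ y :* y
          t = x :- con (+ 1 / 8) :* s
          u = con 1ℚ :- con (+ 2 / 1) :* s
      in r :* (r :* (r :* (r :* (r :* con 1ℚ)))) :- (e₁ :* e₁ :+ e₂ :* e₂) :=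
         con (+ 24 / 1) :* (t :* t) :+ con (+ 21 / 8) :* (s :* s) :+ u :* u :+
         con (+ 9 / 1) :* (s :* (s :* s)) :+ con (+ 5 / 1) :* ((s :* s) :* (s :* s)) :+
         s :* ((s :* s) :* (s :* s)) :+ con (+ 8 / 1) :* (x :* (x :* x)) :+
         con (+ 17 / 1) :* x :+ x) refl x y)
  where
  open +-*-Solver

theorem2 : ∀ (n : ℕ) → 1 ≤ n → Stable (completeBipartite 2 n) × Stable (completeBipartite 3 n)
theorem2 1 _ = stable-2-1 , stable-3-1
theorem2 2 _ = stable-2-2 , stable-3-2
-- From here on the modulus argument covers m = 2; for m = 3 it takes over at n = 5.
theorem2 3 _ = stable-2-large {3} (ℕ.m≤m+n 3 0) , stable-3-3
theorem2 4 _ = stable-2-large {4} (ℕ.m≤m+n 3 1) , stable-3-4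
theorem2 n@(suc (suc (suc (suc (suc k))))) _ =
  stable-2-large {n} (ℕ.m≤m+n 3 (2 ℕ.+ k)) , stable-3-large {n} (ℕ.m≤m+n 5 k)
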